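{- Let $C$ be any fixed nonnegative integer constant and let $\varepsilon \in (0,1)$. There is no deterministic $C$-consistent algorithm for monotone submodular maximization under a cardinality constraint on insertion-only streams that provides a $(2-\varepsilon)$-approximation. That is, for every deterministic streaming algorithm that is $C$-consistent there exist an instance (a cardinality $k\ge 1$, a finite ground set $V$, a monotone normalized submodular function $f:2^V\to\mathbb{R}_{\ge 0}$, and an ordering $e_1,\dots,e_n$ of the elements of $V$) and a time $t\in\{1,\dots,n\}$ such that $(2-\varepsilon)\, f(S_t) < f(\mathrm{OPT}_t)$.
   Context: For a finite set $V$, a function $f:2^V\to\mathbb{R}_{\ge0}$ and $X,Y\subseteq V$, write $f(X\mid Y)=f(X\cup Y)-f(Y)$, and $f(x\mid Y)=f(\{x\}\mid Y)$. $f$ is monotone if $f(e\mid X)\ge 0$ for all $X\subseteq V$, $e\in V$; submodular if $f(e\mid X)\ge f(e\mid Y)$ for all $X\subseteq Y\subseteq V$ and $e\in V\setminus Y$; normalized if $f(\emptyset)=0$. An instance consists of an integer $k\ge1$, a finite set $V$, a monotone normalized submodular $f$ on $V$, and an ordering (stream) $e_1,\dots,e_n$ of the $n$ elements of $V$. Let $V_t=\{e_1,\dots,e_t\}$, and let $\mathrm{OPT}_t$ be a set maximizing $f$ among subsets of $V_t$ of cardinality at most $k$. A deterministic streaming algorithm outputs, after each insertion $e_t$, a solution $S_t\subseteq V_t$ with $|S_t|\le k$ that is a function only of $k$, of the sequence $e_1,\dots,e_t$, and of the values of $f$ on subsets of $V_t$ (no computational restrictions are imposed; future elements of the stream are unknown).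 The algorithm is $C$-consistent if on every instance $|S_t\setminus S_{t-1}|\le C$ for all $t=2,\dots,n$. It provides an $\alpha$-approximation if on every instance $\alpha f(S_t)\ge f(\mathrm{OPT}_t)$ for all $t=1,\dots,n$. -}

module Defs where

open import Algebra.Apartness.Bundles
  using (HeytingCommutativeRing; HeytingField)
open import Algebra.Bundles using (CommutativeRing)
open import Data.Fin.Base using (Fin; inject≤)
open import Data.Fin.Subset
  using (Subset; outside; ⊤; ⊥; ⁅_⁆; _∪_; _─_; _⊆_; _∉_; ∣_∣)
open import Data.Nat.Base as ℕ using (ℕ; suc)
open import Data.Nat.Properties using (<⇒≤)
open import Data.Product.Base using (_×_; ∃-syntax)
open import Data.Sum.Base using (_⊎_)
open import Data.Vec.Base using (padRight)
open import Function.Bundles using (_⇔_)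
open import Function.Definitions using (Injective)
open import Level using (Level; _⊔_) renaming (suc to lsuc)
open import Relation.Binary.Core using (Rel)
open import Relation.Binary.PropositionalEquality.Core using (_≡_)
open import Relation.Binary.Structures using (IsStrictPartialOrder)
open import Relation.Nullary.Negation.Core using (¬_)

import Algebra.Properties.Monoid.Mult as Mult

-- The library has no real numbers, so results are stated over every
-- Archimedean ordered field; the reals are one of them, and so is ℚ.  The
-- order is axiomatised by its strict part in the constructive way: classically
-- _#_ is inequality, and #⇔<⊎> then says that _<_ is trichotomous.
record ArchimedeanOrderedField c ℓ₁ ℓ₂ ℓ₃ : Set (lsuc (c ⊔ ℓ₁ ⊔ ℓ₂ ⊔ ℓ₃)) where
  infix 4 _<_ _≤_
  field
    heytingField : HeytingField c ℓ₁ ℓ₂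

  open HeytingField heytingField public
  open HeytingCommutativeRing heytingCommutativeRing public
    using (commutativeRing)
  open CommutativeRing commutativeRing public using (+-monoid)
  open Mult +-monoid public using () renaming (_×_ to _·_)

  field
    _<_                  : Rel Carrier ℓ₃
    isStrictPartialOrder : IsStrictPartialOrder _≈_ _<_
    #⇔<⊎>                : ∀ {x y} → (x # y) ⇔ (x < y ⊎ y < x)
    +-monoˡ-<            : ∀ z {x y} → x < y → x + z < y + z
    *-pos                : ∀ {x y} → 0# < x → 0# < y → 0# < x * y
    archimedean          : ∀ x → ∃[ n ] x < n · 1#

  _≤_ : Rel Carrier ℓ₃
  x ≤ y = ¬ (y < x)

  2# : Carrier
  2# = 1# + 1#

module SetFunction {c ℓ₁ ℓ₂ ℓ₃} (R : ArchimedeanOrderedField c ℓ₁ ℓ₂ ℓ₃) where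

  open ArchimedeanOrderedField R

  module _ {n : ℕ} (f : Subset n → Carrier) where

    marginal : Subset n → Subset n → Carrier
    marginal X Y = f (X ∪ Y) - f Y

    NonNegative : Set ℓ₃
    NonNegative = ∀ X → 0# ≤ f X

    Monotone : Set ℓ₃
    Monotone = ∀ X x → 0# ≤ marginal ⁅ x ⁆ X

    Submodular : Set ℓ₃
    Submodular = ∀ X Y x → X ⊆ Y → x ∉ Y → marginal ⁅ x ⁆ Y ≤ marginal ⁅ x ⁆ X

    Normalized : Set ℓ₁
    Normalized = f ⊥ ≈ 0#

-- U is the universe from which the elements of ground sets are drawn.
module Streaming
  {c ℓ₁ ℓ₂ ℓ₃ u} (R : ArchimedeanOrderedField c ℓ₁ ℓ₂ ℓ₃) (U : Set u) where

  open ArchimedeanOrderedField R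
  open SetFunction R

  -- The ground set is V = {e 0 , … , e (n - 1)}, streamed in this order (so
  -- e i is the element e_{i+1} of the usual 1-based numbering).  As e is
  -- injective, subsets of V are given by the sets of positions of their
  -- elements.
  record Instance : Set (c ⊔ ℓ₁ ⊔ ℓ₃ ⊔ u) where
    field
      k           : ℕ
      1≤k         : 1 ℕ.≤ k
      n           : ℕ
      e           : Fin n → U
      e-injective : Injective _≡_ _≡_ e
      f           : Subset n → Carrier
      nonNegative : NonNegative f
      monotone    : Monotone f
      normalized  : Normalized f
      submodular  : Submodular f

  -- A subset of the first t elements, seen as a subset of all n elements.
  extend : ∀ {t n} → t ℕ.≤ n → Subset t → Subset n
  extend t≤n = padRight t≤n outside

  module _ (I : Instance) {t : ℕ} (t≤n : t ℕ.≤ Instance.n I) where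

    open Instance I

    Vₜ : Subset n
    Vₜ = extend t≤n ⊤

    ePrefix : Fin t → U
    ePrefix i = e (inject≤ i t≤n)

    fPrefix : Subset t → Carrier
    fPrefix X = f (extend t≤n X)

    IsOPT : Subset n → Set ℓ₃
    IsOPT O = O ⊆ Vₜ × ∣ O ∣ ℕ.≤ k ×
              (∀ X → X ⊆ Vₜ → ∣ X ∣ ℕ.≤ k → f X ≤ f O)

  -- The congruence condition says that run is a function of the elements and
  -- of the values of the set function, up to the equality of the field.
  record Algorithm : Set (c ⊔ ℓ₁ ⊔ ℓ₃ ⊔ u) where
    field
      run      : (k : ℕ) {t : ℕ} → (Fin t → U) → (Subset t → Carrier) → Subset t
      run-cong : ∀ k {t} {e e′ : Fin t → U} {f f′ : Subset t → Carrier} →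
                 (∀ i → e i ≡ e′ i) → (∀ X → f X ≈ f′ X) →
                 run k e f ≡ run k e′ f′

    solution : (I : Instance) {t : ℕ} (t≤n : t ℕ.≤ Instance.n I) →
               Subset (Instance.n I)
    solution I t≤n =
      extend t≤n (run (Instance.k I) (ePrefix I t≤n) (fPrefix I t≤n))

    field
      feasible : ∀ I {t} (t≤n : t ℕ.≤ Instance.n I) →
                 ∣ solution I t≤n ∣ ℕ.≤ Instance.k I

  open Algorithm

  -- The two solutions compared are those after t and after t + 1 insertions.
  Consistent : ℕ → Algorithm → Set (c ⊔ ℓ₁ ⊔ ℓ₃ ⊔ u)
  Consistent C A =
    ∀ I {t} → 1 ℕ.≤ t → (t<n : suc t ℕ.≤ Instance.n I) →
    ∣ solution A I t<n ─ solution A I (<⇒≤ t<n) ∣ ℕ.≤ C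

{-# OPTIONS --safe #-}

-- Stream M = 2k - 1 elements on which f is the cardinality.  Once the algorithm
-- has committed to a set of at most k of them, enlarge that set to a k-set S and
-- let the last element cover exactly S.  The optimum consists of the last element
-- and the k - 1 elements outside S and has value 2k - 1, whereas a solution with
-- at most C new elements covers at most k + C elements; now let k grow.
module Submission where

open import Defs
open import Data.Nat.Base as ℕ using (ℕ)
open import Data.Product.Base using (_×_; Σ-syntax; ∃-syntax)
open import Function.Bundles using (_↣_)

import Algebra.Apartness.Properties.HeytingCommutativeRing as HeytingProperties
import Algebra.Properties.CommutativeMonoid.Mult as CommutativeMonoidMult
import Algebra.Properties.Ring as RingProperties
import Algebra.Properties.Semiring.Mult as SemiringMult
import Data.Nat.Properties as ℕ
import Relation.Binary.Reasoning.Setoid as SetoidReasoning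
open import Algebra.Apartness.Bundles using (HeytingField)
open import Algebra.Bundles using (CommutativeRing)
open import Data.Bool.Base using (true; false; not; _∧_; _∨_)
open import Data.Bool.Properties using (∨-identityʳ; ∨-inverseˡ; ∧-identityʳ; ∧-zeroʳ)
open import Data.Fin.Base using (fromℕ; toℕ)
open import Data.Fin.Properties using (toℕ-injective)
open import Data.Fin.Subset hiding (_-_)
open import Data.Fin.Subset.Properties
open import Data.Nat.Base using (zero; suc; z≤n; s≤s; _≤′_; ≤′-refl; ≤′-step)
open import Data.Nat.Tactic.RingSolver using (solve-∀)
open import Data.Product.Base using (_,_; proj₁; proj₂)
open import Data.Sum.Base using ([_,_]; inj₁; inj₂)
open import Data.Vec.Base using ([]; _∷_; _∷ʳ_; here; lookup; padRight)
open import Data.Vec.Properties using (lookup-zipWith; lookup-replicate; padRight-refl)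
open import Function.Base using (id; _∘_)
open import Function.Bundles using (module Equivalence; module Injection)
open import Relation.Binary.PropositionalEquality
  using (_≡_; refl; sym; trans; cong; cong₂; subst; subst₂)
open import Relation.Binary.Structures using (module IsStrictPartialOrder)

private variable
  m : ℕ

-- Unions, cardinalities and enlargements of finite subsets.

p⊆q⇒p∪q≡q : {p q : Subset m} → p ⊆ q → p ∪ q ≡ q
p⊆q⇒p∪q≡q {p = p} {q} p⊆q =
  ⊆-antisym (λ x∈p∪q → [ p⊆q , id ] (x∈p∪q⁻ p q x∈p∪q)) (q⊆p∪q p q)

∣p∪q∣+∣p∩q∣≡∣p∣+∣q∣ : (p q : Subset m) → ∣ p ∪ q ∣ ℕ.+ ∣ p ∩ q ∣ ≡ ∣ p ∣ ℕ.+ ∣ q ∣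
∣p∪q∣+∣p∩q∣≡∣p∣+∣q∣ []            []            = refl
∣p∪q∣+∣p∩q∣≡∣p∣+∣q∣ (outside ∷ p) (outside ∷ q) = ∣p∪q∣+∣p∩q∣≡∣p∣+∣q∣ p q
∣p∪q∣+∣p∩q∣≡∣p∣+∣q∣ (outside ∷ p) (inside  ∷ q) =
  trans (cong suc (∣p∪q∣+∣p∩q∣≡∣p∣+∣q∣ p q)) (sym (ℕ.+-suc ∣ p ∣ ∣ q ∣))
∣p∪q∣+∣p∩q∣≡∣p∣+∣q∣ (inside  ∷ p) (outside ∷ q) = cong suc (∣p∪q∣+∣p∩q∣≡∣p∣+∣q∣ p q)
∣p∪q∣+∣p∩q∣≡∣p∣+∣q∣ (inside  ∷ p) (inside  ∷ q) = cong suc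
  (trans (ℕ.+-suc _ _)
    (trans (cong suc (∣p∪q∣+∣p∩q∣≡∣p∣+∣q∣ p q)) (sym (ℕ.+-suc ∣ p ∣ ∣ q ∣))))

-- Inclusion-exclusion for `r ∪ p` and `q`: their union contains `r ∪ q` and, as `p ⊆ q`, their
-- intersection contains `p`. With sums in place of differences, this is submodularity of
-- cardinality.
∪-diminishing : (r : Subset m) {p q : Subset m} → p ⊆ q →
                ∣ r ∪ q ∣ ℕ.+ ∣ p ∣ ℕ.≤ ∣ r ∪ p ∣ ℕ.+ ∣ q ∣
∪-diminishing r {p} {q} p⊆q = begin
  ∣ r ∪ q ∣ ℕ.+ ∣ p ∣                    ≤⟨ ℕ.+-mono-≤ (p⊆q⇒∣p∣≤∣q∣ r∪q⊆) (p⊆q⇒∣p∣≤∣q∣ p⊆) ⟩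
  ∣ (r ∪ p) ∪ q ∣ ℕ.+ ∣ (r ∪ p) ∩ q ∣   ≡⟨ ∣p∪q∣+∣p∩q∣≡∣p∣+∣q∣ (r ∪ p) q ⟩
  ∣ r ∪ p ∣ ℕ.+ ∣ q ∣                    ∎
  where
  open ℕ.≤-Reasoning
  r∪q⊆ : r ∪ q ⊆ (r ∪ p) ∪ q
  r∪q⊆ x∈ = [ p⊆p∪q q ∘ p⊆p∪q p , q⊆p∪q (r ∪ p) q ] (x∈p∪q⁻ r q x∈)
  p⊆ : p ⊆ (r ∪ p) ∩ q
  p⊆ x∈p = x∈p∩q⁺ (q⊆p∪q r p x∈p , p⊆q x∈p)

∣p∷ʳoutside∣≡∣p∣ : (p : Subset m) → ∣ p ∷ʳ outside ∣ ≡ ∣ p ∣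
∣p∷ʳoutside∣≡∣p∣ []            = refl
∣p∷ʳoutside∣≡∣p∣ (outside ∷ p) = ∣p∷ʳoutside∣≡∣p∣ p
∣p∷ʳoutside∣≡∣p∣ (inside  ∷ p) = cong suc (∣p∷ʳoutside∣≡∣p∣ p)

∣p∷ʳinside∣≡1+∣p∣ : (p : Subset m) → ∣ p ∷ʳ inside ∣ ≡ suc ∣ p ∣
∣p∷ʳinside∣≡1+∣p∣ []            = refl
∣p∷ʳinside∣≡1+∣p∣ (outside ∷ p) = ∣p∷ʳinside∣≡1+∣p∣ p
∣p∷ʳinside∣≡1+∣p∣ (inside  ∷ p) = cong suc (∣p∷ʳinside∣≡1+∣p∣ p)

padRight-∷ʳ : (m≤1+m : m ℕ.≤ suc m) (p : Subset m) →
              padRight m≤1+m outside p ≡ p ∷ʳ outside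
padRight-∷ʳ z≤n         []      = refl
padRight-∷ʳ (s≤s m≤1+m) (s ∷ p) = cong (s ∷_) (padRight-∷ʳ m≤1+m p)

-- Greedy: an `outside` entry is kept while the tail can still supply `k` elements; once `k` equals
-- the whole remaining length, everything left is taken.
⊆-ofSize : ∀ k (p : Subset m) → ∣ p ∣ ℕ.≤ k → k ℕ.≤ m → ∃[ q ] p ⊆ q × ∣ q ∣ ≡ k
⊆-ofSize zero    []            _         _         = [] , id , refl
⊆-ofSize (suc k) (inside ∷ p) (s≤s ∣p∣≤k) (s≤s k≤n)
  with q , p⊆q , ∣q∣≡k ← ⊆-ofSize k p ∣p∣≤k k≤n = inside ∷ q , s⊆s p⊆q , cong suc ∣q∣≡k
⊆-ofSize k       (outside ∷ p) ∣p∣≤k     k≤1+n with ℕ.m≤n⇒m<n∨m≡n k≤1+n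
... | inj₂ refl      = ⊤ , ⊆⊤ , ∣⊤∣≡n _
... | inj₁ (s≤s k≤n)
  with q , p⊆q , ∣q∣≡k ← ⊆-ofSize k p ∣p∣≤k k≤n = outside ∷ q , s⊆s p⊆q , ∣q∣≡k

-- The coverage map.

-- The union of the sets covered by the elements of X, where the last element
-- covers S and every other element covers itself.
cover : Subset m → Subset (suc m) → Subset m
cover         []      _       = []
cover {suc m} (s ∷ S) (b ∷ X) = (b ∨ (s ∧ lookup X (fromℕ m))) ∷ cover S X

-- Preservation of unions is what transfers monotonicity and submodularity from cardinality to
-- coverage.
cover-∪ : (S : Subset m) (X Y : Subset (suc m)) → cover S (X ∪ Y) ≡ cover S X ∪ cover S Y
cover-∪         []      _       _       = refl
cover-∪ {suc m} (s ∷ S) (b ∷ X) (c ∷ Y) = cong₂ _∷_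
  (trans (cong (λ l → (b ∨ c) ∨ (s ∧ l)) (lookup-zipWith _∨_ (fromℕ m) X Y))
         (interchange b c s _ _))
  (cover-∪ S X Y)
  where
  interchange : ∀ b c s x y → (b ∨ c) ∨ (s ∧ (x ∨ y)) ≡ (b ∨ (s ∧ x)) ∨ (c ∨ (s ∧ y))
  interchange true  _     _     _     _ = refl
  interchange false true  false _     _ = refl
  interchange false true  true  true  _ = refl
  interchange false true  true  false _ = refl
  interchange false false false _     _ = refl
  interchange false false true  _     _ = refl

cover-mono : (S : Subset m) {X Y : Subset (suc m)} → X ⊆ Y → cover S X ⊆ cover S Y
cover-mono S {X} {Y} X⊆Y =
  subst (cover S X ⊆_) (trans (sym (cover-∪ S X Y)) (cong (cover S) (p⊆q⇒p∪q≡q X⊆Y)))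
    (p⊆p∪q (cover S Y))

lookup-∷ʳ-last : (p : Subset m) (s : Side) → lookup (p ∷ʳ s) (fromℕ m) ≡ s
lookup-∷ʳ-last []      s = refl
lookup-∷ʳ-last (_ ∷ p) s = lookup-∷ʳ-last p s

cover-⊥ : (S : Subset m) → cover S ⊥ ≡ ⊥
cover-⊥         []      = refl
cover-⊥ {suc m} (s ∷ S) = cong₂ _∷_
  (trans (cong (s ∧_) (lookup-replicate (fromℕ m) outside)) (∧-zeroʳ s)) (cover-⊥ S)

-- This hides `S` from the algorithm until the last insertion.
cover-∷ʳoutside : (S X : Subset m) → cover S (X ∷ʳ outside) ≡ X
cover-∷ʳoutside []      []      = refl
cover-∷ʳoutside (s ∷ S) (b ∷ X) = cong₂ _∷_
  (trans (cong (λ l → b ∨ (s ∧ l)) (lookup-∷ʳ-last X outside))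
    (trans (cong (b ∨_) (∧-zeroʳ s)) (∨-identityʳ b)))
  (cover-∷ʳoutside S X)

cover-∁∷ʳinside : (S : Subset m) → cover S (∁ S ∷ʳ inside) ≡ ⊤
cover-∁∷ʳinside []      = refl
cover-∁∷ʳinside (s ∷ S) = cong₂ _∷_
  (trans (cong (λ l → _ ∨ (s ∧ l)) (lookup-∷ʳ-last (∁ S) inside))
    (trans (cong (not s ∨_) (∧-identityʳ s)) (∨-inverseˡ s)))
  (cover-∁∷ʳinside S)

-- A position outside `S` can be covered only by its own element; that element is not in `Y`, so it
-- is counted in the difference. Positions in `S` are all charged to `∣ S ∣`, covered or not.
∣cover∣≤∣S∣+∣X─Y∣ : (S : Subset m) (X : Subset (suc m)) (Y : Subset m) → Y ⊆ S →
                   ∣ cover S X ∣ ℕ.≤ ∣ S ∣ ℕ.+ ∣ X ─ (Y ∷ʳ outside) ∣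
∣cover∣≤∣S∣+∣X─Y∣ []            X             []            _   = z≤n
∣cover∣≤∣S∣+∣X─Y∣ (outside ∷ S) (b       ∷ X) (inside  ∷ Y) Y⊆S with () ← Y⊆S here
∣cover∣≤∣S∣+∣X─Y∣ (outside ∷ S) (outside ∷ X) (outside ∷ Y) Y⊆S =
  ∣cover∣≤∣S∣+∣X─Y∣ S X Y (drop-∷-⊆ Y⊆S)
∣cover∣≤∣S∣+∣X─Y∣ (outside ∷ S) (inside  ∷ X) (outside ∷ Y) Y⊆S =
  ℕ.≤-trans (s≤s (∣cover∣≤∣S∣+∣X─Y∣ S X Y (drop-∷-⊆ Y⊆S)))
    (ℕ.≤-reflexive (sym (ℕ.+-suc _ _)))
∣cover∣≤∣S∣+∣X─Y∣ {suc m} (inside  ∷ S) (b ∷ X) (c ∷ Y) Y⊆S =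
  ℕ.≤-trans (∣x∷p∣≤1+∣p∣ (b ∨ lookup X (fromℕ m)) (cover S X))
    (s≤s (ℕ.≤-trans (∣cover∣≤∣S∣+∣X─Y∣ S X Y (drop-∷-⊆ Y⊆S))
      (ℕ.+-monoʳ-≤ ∣ S ∣ (∣p─q∣≤∣x∷p─y∷q∣ b c X (Y ∷ʳ outside)))))
  where
  ∣p─q∣≤∣x∷p─y∷q∣ : ∀ {n} x y (p q : Subset n) → ∣ p ─ q ∣ ℕ.≤ ∣ (x ∷ p) ─ (y ∷ q) ∣
  ∣p─q∣≤∣x∷p─y∷q∣ x inside  p q = ℕ.≤-refl
  ∣p─q∣≤∣x∷p─y∷q∣ x outside p q = ∣p∣≤∣x∷p∣ x (p ─ q)
  ∣x∷p∣≤1+∣p∣ : ∀ {n} x (p : Subset n) → ∣ x ∷ p ∣ ℕ.≤ suc ∣ p ∣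
  ∣x∷p∣≤1+∣p∣ inside  p = ℕ.≤-refl
  ∣x∷p∣≤1+∣p∣ outside p = ℕ.n≤1+n ∣ p ∣

-- Order arithmetic in Archimedean fields.

module OrderedFieldProperties {c ℓ₁ ℓ₂ ℓ₃} (R : ArchimedeanOrderedField c ℓ₁ ℓ₂ ℓ₃) where

  open ArchimedeanOrderedField R hiding (refl; sym; trans)
  open CommutativeRing commutativeRing
    using (ring; semiring; +-commutativeMonoid)
  open RingProperties ring
    using (//-rightDividesˡ; //-rightDividesʳ; -‿distribˡ-*; -‿distribʳ-*; -‿involutive)
  open HeytingProperties (HeytingField.heytingCommutativeRing heytingField)
    using (1#0; x-0≈x)
  open SemiringMult semiring using (×-homo-+; ×-congˡ; ×-congʳ; ×-comm-*; ×-assoc-*)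
  open CommutativeMonoidMult +-commutativeMonoid using (×-distrib-+)
  open IsStrictPartialOrder isStrictPartialOrder public
    using (<-respˡ-≈; <-respʳ-≈) renaming (trans to <-trans; irrefl to <-irrefl)
  module ≈ = CommutativeRing commutativeRing
  open SetoidReasoning setoid

  <-resp₂-≈ : ∀ {w x y z} → w ≈ x → y ≈ z → w < y → x < z
  <-resp₂-≈ w≈x y≈z w<y = <-respʳ-≈ y≈z (<-respˡ-≈ w≈x w<y)

  +-monoʳ-< : ∀ z {x y} → x < y → z + x < z + y
  +-monoʳ-< z x<y = <-resp₂-≈ (+-comm _ z) (+-comm _ z) (+-monoˡ-< z x<y)

  +-cancelʳ-< : ∀ z {x y} → x + z < y + z → x < y
  +-cancelʳ-< z = <-resp₂-≈ (//-rightDividesʳ z _) (//-rightDividesʳ z _) ∘ +-monoˡ-< (- z)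

  x<y⇒0<y-x : ∀ {x y} → x < y → 0# < y - x
  x<y⇒0<y-x {x} = <-respˡ-≈ (-‿inverseʳ x) ∘ +-monoˡ-< (- x)

  0<1 : 0# < 1#
  0<1 with Equivalence.to #⇔<⊎> 1#0
  ... | inj₂ 0<1 = 0<1
  -- This case is not refuted but used: `- 1#` is then positive, and so is its square.
  ... | inj₁ 1<0 = <-respʳ-≈ -1*-1≈1 (*-pos 0<-1 0<-1)
    where
    0<-1 : 0# < - 1#
    0<-1 = <-respʳ-≈ (+-identityˡ (- 1#)) (x<y⇒0<y-x 1<0)
    -1*-1≈1 : - 1# * - 1# ≈ 1#
    -1*-1≈1 = begin
      - 1# * - 1#      ≈⟨ -‿distribˡ-* 1# (- 1#) ⟨
      - (1# * - 1#)    ≈⟨ -‿cong (*-identityˡ (- 1#)) ⟩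
      - (- 1#)         ≈⟨ -‿involutive 1# ⟩
      1#               ∎

  *-monoʳ-< : ∀ {x y z} → 0# < z → x < y → x * z < y * z
  *-monoʳ-< {x} {y} {z} 0<z x<y = +-cancelʳ-< (- (x * z))
    (<-resp₂-≈ (≈.sym (-‿inverseʳ (x * z))) [y-x]*z≈ (*-pos (x<y⇒0<y-x x<y) 0<z))
    where
    [y-x]*z≈ : (y - x) * z ≈ y * z - x * z
    [y-x]*z≈ = ≈.trans (distribʳ z y (- x)) (+-congˡ (≈.sym (-‿distribˡ-* x z)))

  n·x<1+n·x : ∀ n {x} → 0# < x → n · x < suc n · x
  n·x<1+n·x n 0<x = <-respˡ-≈ (+-identityˡ _) (+-monoˡ-< _ 0<x)

  -- As `_≤_` is the negation of `_<_`, mixed transitivity is avoided: here and in `y<n·x`, the gap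
  -- between `m` and `n` is crossed by strict steps of size `x`.
  m·x<y : ∀ {m n x y} → 0# < x → m ℕ.≤ n → n · x < y → m · x < y
  m·x<y 0<x m≤n = go (ℕ.≤⇒≤′ m≤n)
    where
    go : ∀ {m n y} → m ≤′ n → n · _ < y → m · _ < y
    go ≤′-refl              n·x<y = n·x<y
    go (≤′-step {n} m≤′n) n·x<y = go m≤′n (<-trans (n·x<1+n·x n 0<x) n·x<y)

  y<n·x : ∀ {m n x y} → 0# < x → m ℕ.≤ n → y < m · x → y < n · x
  y<n·x 0<x m≤n = go (ℕ.≤⇒≤′ m≤n)
    where
    go : ∀ {m n y} → m ≤′ n → y < m · _ → y < n · _
    go ≤′-refl              y<m·x = y<m·x
    go (≤′-step {n} m≤′n) y<m·x = <-trans (go m≤′n y<m·x) (n·x<1+n·x n 0<x)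

  ·1-mono-≤ : ∀ {m n} → m ℕ.≤ n → m · 1# ≤ n · 1#
  ·1-mono-≤ m≤n n<m = <-irrefl ≈.refl (m·x<y 0<1 m≤n n<m)

  -- The hypothesis avoids truncated subtraction in ℕ.
  ·1-mono-difference : ∀ {a b c d} → a ℕ.+ d ℕ.≤ c ℕ.+ b →
                       a · 1# - b · 1# ≤ c · 1# - d · 1#
  ·1-mono-difference {a} {b} {c} {d} a+d≤c+b c-d<a-b =
    ·1-mono-≤ a+d≤c+b (<-resp₂-≈ eq₁ eq₂ (+-monoˡ-< (b · 1# + d · 1#) c-d<a-b))
    where
    eq₁ : (c · 1# - d · 1#) + (b · 1# + d · 1#) ≈ (c ℕ.+ b) · 1#
    eq₁ = begin
      (c · 1# - d · 1#) + (b · 1# + d · 1#)  ≈⟨ +-congˡ (+-comm _ _) ⟩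
      (c · 1# - d · 1#) + (d · 1# + b · 1#)  ≈⟨ +-assoc _ _ _ ⟨
      (c · 1# - d · 1#) + d · 1# + b · 1#    ≈⟨ +-congʳ (//-rightDividesˡ _ _) ⟩
      c · 1# + b · 1#                        ≈⟨ ×-homo-+ 1# c b ⟨
      (c ℕ.+ b) · 1#                         ∎
    eq₂ : (a · 1# - b · 1#) + (b · 1# + d · 1#) ≈ (a ℕ.+ d) · 1#
    eq₂ = begin
      (a · 1# - b · 1#) + (b · 1# + d · 1#)  ≈⟨ +-assoc _ _ _ ⟨
      (a · 1# - b · 1#) + b · 1# + d · 1#    ≈⟨ +-congʳ (//-rightDividesˡ _ _) ⟩
      a · 1# + d · 1#                        ≈⟨ ×-homo-+ 1# a d ⟨
      (a ℕ.+ d) · 1#                         ∎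

  ·1-mono-0≤ : ∀ {m n} → m ℕ.≤ n → 0# ≤ n · 1# - m · 1#
  ·1-mono-0≤ {m} m≤n n-m<0 = ·1-mono-≤ m≤n
    (<-resp₂-≈ (//-rightDividesˡ _ _) (+-identityˡ _) (+-monoˡ-< (m · 1#) n-m<0))

  -- The axiom is applied to `x * ε⁻¹`, and the bound is multiplied back by `ε`.
  archimedean-at : ∀ {ε} → 0# < ε → ∀ x → ∃[ n ] x < n · ε
  archimedean-at {ε} 0<ε x
    with ε⁻¹ , ε⁻¹*ε≈1 , _ ← #⇒invertible (Equivalence.from #⇔<⊎> (inj₂ 0<ε))
    with n , x*ε⁻¹<n ← archimedean (x * ε⁻¹) =
    n , <-resp₂-≈ eq₁ eq₂ (*-monoʳ-< 0<ε x*ε⁻¹<n)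
    where
    eq₁ : x * ε⁻¹ * ε ≈ x
    eq₁ = begin
      x * ε⁻¹ * ε           ≈⟨ *-assoc x ε⁻¹ ε ⟩
      -- Apartness of `ε` from `0#` yields an inverse of `ε - 0#` rather than of `ε`.
      x * (ε⁻¹ * ε)         ≈⟨ *-congˡ (*-congˡ (x-0≈x ε)) ⟨
      x * (ε⁻¹ * (ε - 0#))  ≈⟨ *-congˡ ε⁻¹*ε≈1 ⟩
      x * 1#                ≈⟨ *-identityʳ x ⟩
      x                     ∎
    eq₂ : n · 1# * ε ≈ n · ε
    eq₂ = ≈.trans (×-assoc-* n 1# ε) (×-congʳ n (*-identityˡ ε))

  -- n (2 - ε) = 2 n - n ε < 2 n - d = m
  [2-ε]*a<m : ∀ {ε a d m n} → 0# < 2# - ε → a ℕ.≤ n → n ℕ.+ n ≡ m ℕ.+ d →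
              d · 1# < n · ε → (2# - ε) * (a · 1#) < m · 1#
  [2-ε]*a<m {ε} {a} {d} {m} {n} 0<2-ε a≤n n+n≡m+d d<nε = <-respˡ-≈ eq₁
    (m·x<y 0<2-ε a≤n (+-cancelʳ-< (n · ε) (<-respˡ-≈ eq₂ (+-monoʳ-< (m · 1#) d<nε))))
    where
    eq₁ : a · (2# - ε) ≈ (2# - ε) * (a · 1#)
    eq₁ = ≈.sym (≈.trans (×-comm-* a (2# - ε) 1#) (×-congʳ a (*-identityʳ _)))
    eq₂ : m · 1# + d · 1# ≈ n · (2# - ε) + n · ε
    eq₂ = begin
      m · 1# + d · 1#         ≈⟨ ×-homo-+ 1# m d ⟨
      (m ℕ.+ d) · 1#          ≈⟨ ×-congˡ n+n≡m+d ⟨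
      (n ℕ.+ n) · 1#          ≈⟨ ×-homo-+ 1# n n ⟩
      n · 1# + n · 1#         ≈⟨ ×-distrib-+ 1# 1# n ⟨
      n · 2#                  ≈⟨ ×-congʳ n (//-rightDividesˡ ε 2#) ⟨
      n · (2# - ε + ε)        ≈⟨ ×-distrib-+ (2# - ε) ε n ⟩
      n · (2# - ε) + n · ε    ∎

-- Coverage functions as streaming instances.

module CoverageInstance
  {c ℓ₁ ℓ₂ ℓ₃ u} (R : ArchimedeanOrderedField c ℓ₁ ℓ₂ ℓ₃) (U : Set u) (ℕ↣U : ℕ ↣ U) where

  open ArchimedeanOrderedField R hiding (refl; sym; trans)
  open SetFunction R
  open Streaming R U
  open OrderedFieldProperties R

  coverage : Subset m → Subset (suc m) → Carrier
  coverage S X = ∣ cover S X ∣ · 1#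

  coverage-monotone : (S : Subset m) → Monotone (coverage S)
  coverage-monotone S X x = ·1-mono-0≤ {∣ cover S X ∣}
    (p⊆q⇒∣p∣≤∣q∣ (cover-mono S (q⊆p∪q ⁅ x ⁆ X)))

  -- By `cover-∪`, adding `x` unites the covered set with `cover S ⁅ x ⁆`, so this is
  -- `∪-diminishing` for the sets covered by `X` and `Y`.
  coverage-submodular : (S : Subset m) → Submodular (coverage S)
  coverage-submodular S X Y x X⊆Y _ = ·1-mono-difference
    {∣ cover S (⁅ x ⁆ ∪ Y) ∣} {∣ cover S Y ∣} {∣ cover S (⁅ x ⁆ ∪ X) ∣}
    (subst₂ (λ A B → ∣ A ∣ ℕ.+ ∣ cover S X ∣ ℕ.≤ ∣ B ∣ ℕ.+ ∣ cover S Y ∣)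
      (sym (cover-∪ S ⁅ x ⁆ Y)) (sym (cover-∪ S ⁅ x ⁆ X))
      (∪-diminishing (cover S ⁅ x ⁆) (cover-mono S X⊆Y)))

  -- The stream is the image of 0, 1, ..., `m` for every `S`; only `f` depends on `S`.
  coverageInstance : (k : ℕ) → 1 ℕ.≤ k → Subset m → Instance
  coverageInstance {m} k 1≤k S = record
    { k           = k
    ; 1≤k         = 1≤k
    ; n           = suc m
    ; e           = Injection.to ℕ↣U ∘ toℕ
    ; e-injective = toℕ-injective ∘ Injection.injective ℕ↣U
    ; f           = coverage S
    ; nonNegative = λ X → ·1-mono-≤ {n = ∣ cover S X ∣} z≤n
    ; monotone    = coverage-monotone S
    ; normalized  = ≈.reflexive (cong (_· 1#) (trans (cong ∣_∣ (cover-⊥ S)) (∣⊥∣≡0 m)))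
    ; submodular  = coverage-submodular S
    }

  coverage-extend : (S : Subset m) (m≤1+m : m ℕ.≤ suc m) (X : Subset m) →
                    coverage S (extend m≤1+m X) ≡ ∣ X ∣ · 1#
  coverage-extend S m≤1+m X = cong (λ Y → ∣ Y ∣ · 1#)
    (trans (cong (cover S) (padRight-∷ʳ m≤1+m X)) (cover-∷ʳoutside S X))

  -- Both runs see the same elements and, by `coverage-extend`, the cardinality as set function.
  solution-indep : (A : Algorithm) (k : ℕ) (1≤k : 1 ℕ.≤ k) (m≤1+m : m ℕ.≤ suc m)
                   (S T : Subset m) →
                   Algorithm.solution A (coverageInstance k 1≤k S) m≤1+m ≡
                   Algorithm.solution A (coverageInstance k 1≤k T) m≤1+m
  solution-indep A k 1≤k m≤1+m S T = cong (extend m≤1+m)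
    (Algorithm.run-cong A k (λ _ → refl)
      (λ X → ≈.reflexive (trans (coverage-extend S m≤1+m X) (sym (coverage-extend T m≤1+m X)))))

-- The adversarial choice of the set covered by the last element.

module Adversary
  {c ℓ₁ ℓ₂ ℓ₃ u} (R : ArchimedeanOrderedField c ℓ₁ ℓ₂ ℓ₃) (U : Set u) (ℕ↣U : ℕ ↣ U)
  (A : Streaming.Algorithm R U) (C : ℕ) (consistent : Streaming.Consistent R U C A) (N : ℕ)
  where

  open ArchimedeanOrderedField R hiding (refl; sym; trans)
  open Streaming R U
  open OrderedFieldProperties R
  open CoverageInstance R U ℕ↣U

  -- The complement of a `k`-set in `M` positions has `N` elements, leaving room for exactly one
  -- more.
  k M : ℕ
  k = suc N
  M = N ℕ.+ k

  I : Subset M → Instance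
  I = coverageInstance k (s≤s z≤n)

  -- This is the very proof that `Consistent` forms from `ℕ.≤-refl`, so the two solutions agree
  -- definitionally.
  M≤1+M : M ℕ.≤ suc M
  M≤1+M = ℕ.<⇒≤ ℕ.≤-refl

  -- S does not influence f before the last element arrives, so the solution
  -- on which S will depend can be computed with S = ⊥.
  early : Subset M
  early = Algorithm.run A k (ePrefix (I ⊥) M≤1+M) (fPrefix (I ⊥) M≤1+M)

  ∣early∣≤k : ∣ early ∣ ℕ.≤ k
  ∣early∣≤k = subst (ℕ._≤ k)
    (trans (cong ∣_∣ (padRight-∷ʳ M≤1+M early)) (∣p∷ʳoutside∣≡∣p∣ early))
    (Algorithm.feasible A (I ⊥) M≤1+M)

  solution≡early : ∀ S → Algorithm.solution A (I S) M≤1+M ≡ early ∷ʳ outside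
  solution≡early S = trans (solution-indep A k (s≤s z≤n) M≤1+M S ⊥) (padRight-∷ʳ M≤1+M early)

  trap : ∃[ S ] early ⊆ S × ∣ S ∣ ≡ k
  trap = ⊆-ofSize k early ∣early∣≤k (ℕ.m≤n+m k N)

  S : Subset M
  S = proj₁ trap

  ∣S∣≡k : ∣ S ∣ ≡ k
  ∣S∣≡k = proj₂ (proj₂ trap)

  late O : Subset (suc M)
  late = Algorithm.solution A (I S) ℕ.≤-refl
  O    = ∁ S ∷ʳ inside

  -- Since `early ⊆ S`, only newly inserted elements can cover positions outside `S`, and
  -- consistency allows at most `C` of them.
  ∣cover-late∣≤k+C : ∣ cover S late ∣ ℕ.≤ k ℕ.+ C
  ∣cover-late∣≤k+C = ℕ.≤-trans (∣cover∣≤∣S∣+∣X─Y∣ S late early (proj₁ (proj₂ trap)))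
    (ℕ.+-mono-≤ (ℕ.≤-reflexive ∣S∣≡k)
      (subst (λ X → ∣ late ─ X ∣ ℕ.≤ C) (solution≡early S)
        (consistent (I S) (ℕ.m≤n⇒m≤o+n N (s≤s z≤n)) ℕ.≤-refl)))

  coverage-O : coverage S O ≡ M · 1#
  coverage-O = cong (_· 1#) (trans (cong ∣_∣ (cover-∁∷ʳinside S)) (∣⊤∣≡n M))

  ∣O∣≡k : ∣ O ∣ ≡ k
  ∣O∣≡k = trans (∣p∷ʳinside∣≡1+∣p∣ (∁ S)) (cong suc
    (trans (∣∁p∣≡n∸∣p∣ S) (trans (cong (M ℕ.∸_) ∣S∣≡k) (ℕ.m+n∸n≡m N k))))

  -- `O` covers all `M` positions, and no set covers more.
  O-isOPT : IsOPT (I S) ℕ.≤-refl O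
  O-isOPT = subst (O ⊆_) (sym (padRight-refl outside ⊤)) ⊆⊤
          , ℕ.≤-reflexive ∣O∣≡k
          , λ X _ _ fO<fX → ·1-mono-≤ (∣p∣≤n (cover S X)) (subst (_< coverage S X) coverage-O fO<fX)

theorem3p1 : ∀ {c ℓ₁ ℓ₂ ℓ₃ u} (R : ArchimedeanOrderedField c ℓ₁ ℓ₂ ℓ₃)
    (U : Set u) → ℕ ↣ U →
    let open ArchimedeanOrderedField R
        open Streaming R U
        open Instance
        open Algorithm
    in
    (C : ℕ) (ε : Carrier) → 0# < ε → ε < 1# →
    (A : Algorithm) → Consistent C A →
    Σ[ I ∈ Instance ] ∃[ t ] 1 ℕ.≤ t × Σ[ t≤n ∈ t ℕ.≤ n I ] ∃[ O ]
      IsOPT I t≤n O × (2# - ε) * f I (solution A I t≤n) < f I O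
theorem3p1 R U ℕ↣U C ε 0<ε ε<1 A consistent =
  I S , suc M , s≤s z≤n , ℕ.≤-refl , O , O-isOPT ,
  subst ((2# - ε) * coverage S late <_) (sym coverage-O)
    -- `d` is the excess of twice the bound `k + C` over the optimum: 2(k + C) - (2k - 1) = 2C + 1.
    ([2-ε]*a<m {d = suc (C ℕ.+ C)} 0<2-ε ∣cover-late∣≤k+C (arith N C)
      -- `N` was chosen with 2C + 1 < N ε; the bound persists for `k + C`, which is at least `N`.
      (y<n·x 0<ε (ℕ.m≤n⇒m≤1+n (ℕ.m≤m+n N C)) (proj₂ size)))
  where
  open ArchimedeanOrderedField R hiding (refl; sym; trans)
  open OrderedFieldProperties R
  open CoverageInstance R U ℕ↣U

  size : ∃[ n ] suc (C ℕ.+ C) · 1# < n · ε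
  size = archimedean-at 0<ε (suc (C ℕ.+ C) · 1#)

  N : ℕ
  N = proj₁ size

  open Adversary R U ℕ↣U A C consistent N

  0<2-ε : 0# < 2# - ε
  0<2-ε = x<y⇒0<y-x (<-trans ε<1 (<-respˡ-≈ (+-identityʳ 1#) (+-monoʳ-< 1# 0<1)))

  arith : ∀ N C → (suc N ℕ.+ C) ℕ.+ (suc N ℕ.+ C) ≡ (N ℕ.+ suc N) ℕ.+ suc (C ℕ.+ C)
  arith = solve-∀
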